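{- For every integer $n\geq 3$, writing $f_q(n)$ for the total number of occurrences of the pattern $q$ in all permutations of $S_n(132,231)$, we have $$f_{123}(n)=f_{213}(n)=f_{312}(n)=f_{321}(n)=\binom{n}{3}2^{n-3}.$$
   Context: $S_n$ is the set of permutations of $\{1,\dots,n\}$ written in one-line notation $\sigma=\sigma_1\sigma_2\cdots\sigma_n$. For $q\in S_k$, an occurrence of the pattern $q$ in $\sigma\in S_n$ is a choice of indices $i_1<i_2<\cdots<i_k$ in $\{1,\dots,n\}$ such that for all $1\le j,l\le k$, $q_j<q_l$ if and only if $\sigma_{i_j}<\sigma_{i_l}$. Let $f_q(\sigma)$ be the number of occurrences of $q$ in $\sigma$; $\sigma$ avoids $q$ if $f_q(\sigma)=0$. $S_n(132,231)$ is the set of permutations in $S_n$ avoiding both $132$ and $231$, and $f_q(n)=\sum_{\sigma\in S_n(132,231)}f_q(\sigma)$. -}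

module Defs where

open import Data.Fin.Base using (Fin; _<_)
open import Data.Fin.Patterns using (0F; 1F; 2F)
open import Data.Fin.Properties using (_≟_; _<?_; all?)
open import Data.List.Base as List
  using (List; allFin; cartesianProductWith; filter; length; map)
open import Data.List.Membership.Propositional using (_∈_)
open import Data.List.Membership.Propositional.Properties
  using (∈-allFin; ∈-cartesianProductWith⁺; ∈-filter⁺; ∈-filter⁻)
import Data.List.Relation.Unary.All as ListAll
import Data.List.Relation.Unary.AllPairs as ListAllPairs
open import Data.List.Relation.Unary.Any using (here)
import Data.List.Relation.Unary.Unique.Propositional as ListUnique
import Data.List.Relation.Unary.Unique.Propositional.Properties as ListUniqueₚ
open import Data.Nat.Base using (ℕ; zero; suc)
import Data.Nat.Properties as ℕₚ
open import Data.Nat.ListAction using (sum)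
open import Data.Product.Base using (_×_; _,_; proj₂)
open import Data.Vec.Base using (Vec; []; _∷_; lookup)
open import Data.Vec.Properties using (∷-injective)
open import Data.Vec.Relation.Unary.AllPairs using (allPairs?)
open import Data.Vec.Relation.Unary.Linked using (Linked; linked?)
open import Data.Vec.Relation.Unary.Unique.Propositional using (Unique)
open import Function.Bundles using (_⇔_; mk⇔; Equivalence)
open import Relation.Binary.PropositionalEquality using (_≡_; refl)
open import Relation.Nullary.Decidable
  using (Dec; map′; ¬?; _×-dec_; _→-dec_)

private
  variable
    k n : ℕ

-- Letters and positions are taken in Fin n = {0, …, n-1} instead of
-- {1, …, n}.  A word of length n over Fin n is the one-line notation
-- of a permutation exactly when its letters are pairwise distinct.

Word : ℕ → ℕ → Set
Word n k = Vec (Fin n) k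

words : ∀ n k → List (Word n k)
words n zero    = List.[ [] ]
words n (suc k) = cartesianProductWith _∷_ (allFin n) (words n k)

IsPermutation : Word n n → Set
IsPermutation σ = Unique σ

isPermutation? : (σ : Word n n) → Dec (IsPermutation σ)
isPermutation? = allPairs? (λ x y → ¬? (x ≟ y))

S : ∀ n → List (Word n n)
S n = filter isPermutation? (words n n)

-- `is` lists the positions i₁ < ⋯ < iₖ of the occurrence.

IsOccurrence : Word k k → Word n n → Word n k → Set
IsOccurrence q σ is =
  Linked _<_ is ×
  (∀ j l → lookup q j < lookup q l
             ⇔ lookup σ (lookup is j) < lookup σ (lookup is l))

infix 3 _⇔-dec_

_⇔-dec_ : {A B : Set} → Dec A → Dec B → Dec (A ⇔ B)
a? ⇔-dec b? =
  map′ (λ (to , from) → mk⇔ to from)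
       (λ e → Equivalence.to e , Equivalence.from e)
       ((a? →-dec b?) ×-dec (b? →-dec a?))

isOccurrence? : (q : Word k k) (σ : Word n n) (is : Word n k) →
                Dec (IsOccurrence q σ is)
isOccurrence? q σ is =
  linked? _<?_ is ×-dec
  all? (λ j → all? (λ l →
    (lookup q j <? lookup q l)
      ⇔-dec (lookup σ (lookup is j) <? lookup σ (lookup is l))))

occurrences : Word k k → Word n n → ℕ
occurrences {k} {n} q σ = length (filter (isOccurrence? q σ) (words n k))

Avoids : Word k k → Word n n → Set
Avoids q σ = occurrences q σ ≡ 0

avoids? : (q : Word k k) (σ : Word n n) → Dec (Avoids q σ)
avoids? q σ = occurrences q σ ℕₚ.≟ 0

p123 p132 p213 p231 p312 p321 : Word 3 3
p123 = 0F ∷ 1F ∷ 2F ∷ []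
p132 = 0F ∷ 2F ∷ 1F ∷ []
p213 = 1F ∷ 0F ∷ 2F ∷ []
p231 = 1F ∷ 2F ∷ 0F ∷ []
p312 = 2F ∷ 0F ∷ 1F ∷ []
p321 = 2F ∷ 1F ∷ 0F ∷ []

S[132,231] : ∀ n → List (Word n n)
S[132,231] n = filter (λ σ → avoids? p132 σ ×-dec avoids? p231 σ) (S n)

f : Word k k → ℕ → ℕ
f q n = sum (map (occurrences q) (S[132,231] n))

-- The enumerations are complete and free of repetitions, so the sums
-- and lengths above are genuine sums over, and cardinalities of, sets.

∈-words : (w : Word n k) → w ∈ words n k
∈-words []      = here refl
∈-words (x ∷ w) = ∈-cartesianProductWith⁺ _∷_ (∈-allFin x) (∈-words w)

words-unique : ∀ n k → ListUnique.Unique (words n k)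
words-unique n zero    = ListAll.[] ListAllPairs.∷ ListAllPairs.[]
words-unique n (suc k) =
  ListUniqueₚ.cartesianProductWith⁺ _∷_ ∷-injective
    (ListUniqueₚ.allFin⁺ n) (words-unique n k)

∈-S : (σ : Word n n) → σ ∈ S n ⇔ IsPermutation σ
∈-S {n} σ = mk⇔
  (λ σ∈S → proj₂ (∈-filter⁻ isPermutation? {xs = words n n} σ∈S))
  (∈-filter⁺ isPermutation? (∈-words σ))

S-unique : ∀ n → ListUnique.Unique (S n)
S-unique n = ListUniqueₚ.filter⁺ isPermutation? (words-unique n n)

{-# OPTIONS --safe #-}
module Submission where

-- A permutation avoiding 132 and 231 has no interior peak, so its largest letter
-- is first or last, and deleting that letter leaves a permutation of the same
-- kind; for n ≥ 1 both insertions are possible and give different permutations.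
-- Each q among 123, 213, 312, 321 arises in the same way from a pattern q′ of
-- length 2.  Inserting a maximum at the end where q has its own creates one new
-- occurrence of q per occurrence of q′; inserting it at the other end creates
-- none.  Hence f_q(n+1) = 2 f_q(n) + f_q′(n) for n ≥ 1, and the same step from
-- length 1 to 2, so 2^k f_q(n) = C(n,k) 2^n by induction via Pascal's rule.

open import Defs
open import Data.Fin.Base using (Fin; zero; suc; fromℕ; punchIn; punchOut; _<_)
open import Data.Fin.Patterns using (0F; 1F)
open import Data.Fin.Properties
  using (_≟_; any?; ≤fromℕ; <-cmp; <-irrefl; <-asym; <-trans; ≤∧≢⇒<; injective⇒≤;
         punchIn-injective; punchInᵢ≢i; punchIn-mono-≤; punchIn-cancel-≤;
         punchIn-punchOut)
open import Data.List.Base using (List; []; _∷_; _++_; filter; length; map)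
open import Data.List.Membership.Propositional using (_∈_)
open import Data.List.Membership.Propositional.Properties
  using (∈-filter⁺; ∈-filter⁻; ∈-map⁺; ∈-map⁻; ∈-++⁺ˡ; ∈-++⁺ʳ; ∈-++⁻; ∈-length)
open import Data.List.Membership.Propositional.Properties.WithK using (unique∧set⇒bag)
open import Data.List.Properties using (length-map; length-++; map-++; map-∘; map-cong)
open import Data.List.Relation.Binary.BagAndSetEquality using (∼bag⇒↭)
open import Data.List.Relation.Binary.Permutation.Propositional using (_↭_)
import Data.List.Relation.Binary.Permutation.Propositional.Properties as ↭ₚ
open import Data.List.Relation.Unary.Unique.Propositional
  using ([]; _∷_) renaming (Unique to UniqueList)
import Data.List.Relation.Unary.Unique.Propositional.Properties as UniqueListₚ
open import Data.Nat.Base using (ℕ; zero; suc; _≥_; _+_; _*_; _∸_; _^_; s≤s; z≤n; s<s; z<s)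
open import Data.Nat.Combinatorics using (_C_; nCk+nC[k+1]≡[n+1]C[k+1]; nC1≡n; k>n⇒nCk≡0)
open import Data.Nat.ListAction using (sum)
open import Data.Nat.ListAction.Properties using (sum-++; sum-↭)
import Data.Nat.Properties as ℕₚ
open import Data.Nat.Tactic.RingSolver using (solve-∀)
open import Data.Product.Base using (_×_; _,_; proj₁; proj₂; ∃; ∃₂)
open import Data.Product.Function.NonDependent.Propositional using (_×-⇔_)
open import Data.Sum.Base using (_⊎_; inj₁; inj₂)
open import Data.Vec.Base as Vec using ([]; _∷_; lookup; insertAt; tabulate; removeAt)
open import Data.Vec.Properties
  using (insertAt-lookup; insertAt-punchIn; insertAt-removeAt; removeAt-insertAt;
         lookup-map; tabulate-∘; tabulate-cong; tabulate∘lookup; ∷-injective)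
open import Data.Vec.Relation.Unary.Linked using (Linked; []; [-]; _∷_)
import Data.Vec.Relation.Unary.Linked.Properties as Linkedₚ
open import Data.Vec.Relation.Unary.Unique.Propositional using (Unique)
import Data.Vec.Relation.Unary.Unique.Propositional.Properties as Uniqueₚ
open import Function.Base using (_∘_)
open import Function.Bundles using (_⇔_; mk⇔; Equivalence)
open import Function.Definitions using (Injective)
import Function.Properties.Equivalence as ⇔
open import Relation.Binary.Definitions using (tri<; tri≈; tri>)
open import Relation.Binary.PropositionalEquality
open import Relation.Nullary.Decidable using (Dec; yes; no; _×-dec_)
open import Relation.Nullary.Negation using (contradiction)

open Equivalence using (to; from)

private
  variable
    A B X : Set
    k m n : ℕ

-- Two repetition-free lists with the same members are equal as bags, hence rearrangements of each
-- other. This serves twice: it splits the occurrences in an enlarged word by whether they use the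
-- new position, and the avoiders by the end that holds their maximum.
↭-map-++-map : {xs : List X} {as : List A} {bs : List B} {g : A → X} {h : B → X} →
  UniqueList xs → UniqueList as → UniqueList bs →
  Injective _≡_ _≡_ g → Injective _≡_ _≡_ h → (∀ {a b} → g a ≢ h b) →
  (∀ {x} → x ∈ xs → (∃ λ a → a ∈ as × x ≡ g a) ⊎ (∃ λ b → b ∈ bs × x ≡ h b)) →
  (∀ {a} → a ∈ as → g a ∈ xs) → (∀ {b} → b ∈ bs → h b ∈ xs) →
  xs ↭ map g as ++ map h bs
↭-map-++-map {xs = xs} {as} {bs} {g} {h} xs! as! bs! g-inj h-inj g≢h split g∈ h∈ =
  ∼bag⇒↭ (unique∧set⇒bag xs! unique (mk⇔ (into ∘ split) (back ∘ ∈-++⁻ (map g as))))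
  where
  unique : UniqueList (map g as ++ map h bs)
  unique = UniqueListₚ.++⁺ (UniqueListₚ.map⁺ g-inj as!) (UniqueListₚ.map⁺ h-inj bs!)
    λ (x∈g , x∈h) → let (_ , _ , x≡g) = ∈-map⁻ g x∈g ; (_ , _ , x≡h) = ∈-map⁻ h x∈h
                    in g≢h (trans (sym x≡g) x≡h)

  into : ∀ {x} → (∃ λ a → a ∈ as × x ≡ g a) ⊎ (∃ λ b → b ∈ bs × x ≡ h b) →
         x ∈ map g as ++ map h bs
  into (inj₁ (_ , a∈ , refl)) = ∈-++⁺ˡ (∈-map⁺ g a∈)
  into (inj₂ (_ , b∈ , refl)) = ∈-++⁺ʳ (map g as) (∈-map⁺ h b∈)

  back : ∀ {x} → x ∈ map g as ⊎ x ∈ map h bs → x ∈ xs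
  back (inj₁ x∈) with _ , a∈ , refl ← ∈-map⁻ g x∈ = g∈ a∈
  back (inj₂ x∈) with _ , b∈ , refl ← ∈-map⁻ h x∈ = h∈ b∈

∈-filter-⇔ : {P : A → Set} (P? : ∀ x → Dec (P x)) (xs : List A) (x : A) →
  x ∈ filter P? xs ⇔ (x ∈ xs × P x)
∈-filter-⇔ P? xs x = mk⇔ (∈-filter⁻ P? {xs = xs}) (λ (x∈ , px) → ∈-filter⁺ P? x∈ px)

-- The order on `Fin` under `punchIn`.

data PunchView (p : Fin (suc n)) : Fin (suc n) → Set where
  at  : PunchView p p
  off : ∀ i → PunchView p (punchIn p i)

punchView : (p i : Fin (suc n)) → PunchView p i
punchView p i with p ≟ i
... | yes refl = at
... | no p≢i   = subst (PunchView p) (punchIn-punchOut p≢i) (off (punchOut p≢i))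

punchIn-mono-< : (p : Fin (suc n)) {i j : Fin n} → i < j → punchIn p i < punchIn p j
punchIn-mono-< p {i} {j} i<j = ≤∧≢⇒< (punchIn-mono-≤ p i j (ℕₚ.<⇒≤ i<j))
  λ eq → <-irrefl (punchIn-injective p i j eq) i<j

punchIn-cancel-< : (p : Fin (suc n)) {i j : Fin n} → punchIn p i < punchIn p j → i < j
punchIn-cancel-< p {i} {j} i<j = ≤∧≢⇒< (punchIn-cancel-≤ p i j (ℕₚ.<⇒≤ i<j))
  λ eq → <-irrefl (cong (punchIn p) eq) i<j

punchIn-<-⇔ : (p : Fin (suc n)) {a b : Fin (suc n)} {i j : Fin n} →
  a ≡ punchIn p i → b ≡ punchIn p j → (a < b) ⇔ (i < j)
punchIn-<-⇔ p refl refl = mk⇔ (punchIn-cancel-< p) (punchIn-mono-< p)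

fromℕ≮ : (i : Fin (suc n)) → fromℕ n < i → A
fromℕ≮ i n<i = contradiction n<i (ℕₚ.≤⇒≯ (≤fromℕ i))

punchIn-fromℕ< : (i : Fin n) → punchIn (fromℕ n) i < fromℕ n
punchIn-fromℕ< i = ≤∧≢⇒< (≤fromℕ _) (punchInᵢ≢i _ i)

-- Inserting an entry into a word.

data End : Set where
  first last : End

end : End → Fin (suc n)
end first = zero
end last  = fromℕ _

-- The sizes `m` and `n` are independent because an inequality between indices of a list of
-- positions has to yield one between positions in the word. One of the two directions is vacuous at
-- each end.
end-< : ∀ e {i : Fin m} {j : Fin n} →
  end {m} e < punchIn (end e) i → end {n} e < punchIn (end e) j
end-< first _        = z<s
end-< last  {i} n<i  = fromℕ≮ _ n<i

<-end : ∀ e {i : Fin m} {j : Fin n} →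
  punchIn (end e) i < end {m} e → punchIn (end e) j < end {n} e
<-end first ()
<-end last  {j = j} _ = punchIn-fromℕ< j

-- Applied both to words, with v the largest letter, and to lists of positions.

graft : Fin (suc k) → Fin (suc n) → Word n k → Word (suc n) (suc k)
graft p v w = insertAt (Vec.map (punchIn v) w) p v

lookup-map-punchIn : (v : Fin (suc n)) (w : Word n k) (i : Fin k) →
  lookup (Vec.map (punchIn v) w) i ≡ punchIn v (lookup w i)
lookup-map-punchIn v w i = lookup-map i (punchIn v) w

lookup-graft-at : (p : Fin (suc k)) (v : Fin (suc n)) (w : Word n k) →
  lookup (graft p v w) p ≡ v
lookup-graft-at p v w = insertAt-lookup (Vec.map (punchIn v) w) p v

lookup-graft-off : (p : Fin (suc k)) (v : Fin (suc n)) (w : Word n k) (i : Fin k) →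
  lookup (graft p v w) (punchIn p i) ≡ punchIn v (lookup w i)
lookup-graft-off p v w i =
  trans (insertAt-punchIn (Vec.map (punchIn v) w) p v i) (lookup-map-punchIn v w i)

map-injective : {g : A → B} → Injective _≡_ _≡_ g → Injective _≡_ _≡_ (Vec.map {n = n} g)
map-injective g-inj {[]}     {[]}     _  = refl
map-injective g-inj {x ∷ xs} {y ∷ ys} eq =
  cong₂ _∷_ (g-inj (proj₁ (∷-injective eq))) (map-injective g-inj (proj₂ (∷-injective eq)))

map-punchIn-injective : (v : Fin (suc n)) → Injective _≡_ _≡_ (Vec.map {n = k} (punchIn v))
map-punchIn-injective v = map-injective (punchIn-injective v _ _)

graft-injective : (p : Fin (suc k)) (v : Fin (suc n)) → Injective _≡_ _≡_ (graft p v)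
graft-injective p v {w} {w′} eq = map-punchIn-injective v
  (trans (sym (removeAt-insertAt _ p v)) (trans (cong (λ u → removeAt u p) eq)
    (removeAt-insertAt _ p v)))

omits⇒map-punchIn : (v : Fin (suc n)) (w : Word (suc n) k) → (∀ i → v ≢ lookup w i) →
  ∃ λ w′ → w ≡ Vec.map (punchIn v) w′
omits⇒map-punchIn v w v∉w = tabulate (λ i → punchOut (v∉w i)) , (begin
  w
    ≡⟨ tabulate∘lookup w ⟨
  tabulate (lookup w)
    ≡⟨ tabulate-cong (λ i → punchIn-punchOut (v∉w i)) ⟨
  tabulate (λ i → punchIn v (punchOut (v∉w i)))
    ≡⟨ tabulate-∘ (punchIn v) _ ⟩
  Vec.map (punchIn v) (tabulate λ i → punchOut (v∉w i))
    ∎)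
  where open ≡-Reasoning

-- Removing the entry at `p` leaves a word that omits `v`, and such a word factors through
-- `punchIn v`.
occurs-once⇒graft : (p : Fin (suc k)) (v : Fin (suc n)) (w : Word (suc n) (suc k)) →
  lookup w p ≡ v → (∀ i → v ≢ lookup w (punchIn p i)) → ∃ λ w′ → w ≡ graft p v w′
occurs-once⇒graft p v w refl v∉rest =
  let w′ , eq = omits⇒map-punchIn v (removeAt w p) λ i v≡ →
        v∉rest i (trans v≡ (trans (sym (insertAt-punchIn (removeAt w p) p v i))
          (cong (λ u → lookup u (punchIn p i)) (insertAt-removeAt w p))))
  in w′ , trans (sym (insertAt-removeAt w p)) (cong (λ u → insertAt u p v) eq)

-- Increasing lists of positions.

Increasing : Word n k → Set
Increasing is = ∀ i j → i < j → lookup is i < lookup is j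

-- `Linked` compares neighbours only, and an insertion changes which entries are neighbours. The
-- form quantified over all pairs is transported index by index instead.
Increasing⇒Linked : (is : Word n k) → Increasing is → Linked _<_ is
Increasing⇒Linked []           _   = []
Increasing⇒Linked (x ∷ [])     _   = [-]
Increasing⇒Linked (x ∷ y ∷ is) inc =
  inc 0F 1F z<s ∷ Increasing⇒Linked (y ∷ is) (λ i j i<j → inc (suc i) (suc j) (s<s i<j))

Linked⇒Increasing : (is : Word n k) → Linked _<_ is → Increasing is
Linked⇒Increasing is linked i j =
  Linkedₚ.lookup⁺ (λ {i} {j} {k} → <-trans {i = i} {j} {k}) linked

Increasing-map-punchIn : (v : Fin (suc n)) (is : Word n k) →
  Increasing (Vec.map (punchIn v) is) ⇔ Increasing is
Increasing-map-punchIn v is = mk⇔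
  (λ inc i j i<j → to (<⇔ i j) (inc i j i<j)) (λ inc i j i<j → from (<⇔ i j) (inc i j i<j))
  where
  <⇔ : ∀ i j → (lookup (Vec.map (punchIn v) is) i < lookup (Vec.map (punchIn v) is) j) ⇔
               (lookup is i < lookup is j)
  <⇔ i j = punchIn-<-⇔ v (lookup-map-punchIn v is i) (lookup-map-punchIn v is j)

-- Index and value are the same end: the least position can only be put first, the greatest only
-- last.
Increasing-graft : ∀ e (is : Word n k) →
  Increasing (graft (end e) (end e) is) ⇔ Increasing is
Increasing-graft e is = mk⇔
  (λ inc i j i<j → punchIn-cancel-< (end e)
    (subst₂ _<_ (lookup-graft-off (end e) (end e) is i) (lookup-graft-off (end e) (end e) is j)
      (inc _ _ (punchIn-mono-< (end e) i<j))))
  (λ inc i j → grafted inc (punchView (end e) i) (punchView (end e) j))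
  where
  grafted : Increasing is → ∀ {i j} → PunchView (end e) i → PunchView (end e) j → i < j →
            lookup (graft (end e) (end e) is) i < lookup (graft (end e) (end e) is) j
  grafted inc at at i<j = contradiction i<j (<-irrefl refl)
  grafted inc at (off j) i<j
    rewrite lookup-graft-at (end e) (end e) is | lookup-graft-off (end e) (end e) is j
    = end-< e i<j
  grafted inc (off i) at i<j
    rewrite lookup-graft-at (end e) (end e) is | lookup-graft-off (end e) (end e) is i
    = <-end e i<j
  grafted inc (off i) (off j) i<j
    rewrite lookup-graft-off (end e) (end e) is i | lookup-graft-off (end e) (end e) is j
    = punchIn-mono-< (end e) (inc i j (punchIn-cancel-< (end e) i<j))

-- At any other index, the entry at `end e` of the list would have to lie strictly beyond the
-- extreme position.
lookup≡end⇒≡end : ∀ e (is : Word (suc n) (suc k)) → Increasing is →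
  ∀ i → lookup is i ≡ end e → i ≡ end e
lookup≡end⇒≡end e is inc i eq with punchView (end e) i
lookup≡end⇒≡end e     is inc _ eq | at = refl
lookup≡end⇒≡end first is inc _ eq | off j
  with () ← subst (lookup is 0F <_) eq (inc 0F (suc j) z<s)
lookup≡end⇒≡end last  is inc _ eq | off j =
  fromℕ≮ _ (subst (_< lookup is (fromℕ _)) eq (inc _ _ (punchIn-fromℕ< j)))

-- Testing the single entry at index `end e` suffices: by `lookup≡end⇒≡end` the position `end e` can
-- appear nowhere else in the list.
increasing-split : ∀ e (is : Word (suc n) (suc k)) → Increasing is →
  (∃ λ js → is ≡ Vec.map (punchIn (end e)) js) ⊎ (∃ λ js → is ≡ graft (end e) (end e) js)
increasing-split e is inc with lookup is (end e) ≟ end e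
... | yes eq = inj₂ (occurs-once⇒graft (end e) (end e) is eq λ i ≡i →
        punchInᵢ≢i (end e) i (lookup≡end⇒≡end e is inc _ (sym ≡i)))
... | no neq = inj₁ (omits⇒map-punchIn (end e) is λ i ≡i →
        neq (subst (λ j → lookup is j ≡ end e) (lookup≡end⇒≡end e is inc i (sym ≡i)) (sym ≡i)))

-- Relative order under insertion of a maximum.

graftMax : Fin (suc n) → Word n n → Word (suc n) (suc n)
graftMax p σ = graft p (fromℕ _) σ

lookup-graftMax-< : {p i : Fin (suc n)} (σ : Word n n) → i ≢ p →
  lookup (graftMax p σ) i < lookup (graftMax p σ) p
lookup-graftMax-< {p = p} {i} σ i≢p with punchView p i
... | at    = contradiction refl i≢p
... | off j = subst₂ _<_ (sym (lookup-graft-off p _ σ j)) (sym (lookup-graft-at p _ σ))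
                (punchIn-fromℕ< (lookup σ j))

-- The second half of `IsOccurrence`, separated because it survives an insertion at any position,
-- whereas monotonicity of the positions ties the insertion to an end.
SameOrder : Word k k → Word n n → Word n k → Set
SameOrder q σ is =
  ∀ j l → (lookup q j < lookup q l) ⇔ (lookup σ (lookup is j) < lookup σ (lookup is l))

lookup-graftMax-map : (p : Fin (suc n)) (σ : Word n n) (is : Word n k) (i : Fin k) →
  lookup (graftMax p σ) (lookup (Vec.map (punchIn p) is) i) ≡
  punchIn (fromℕ n) (lookup σ (lookup is i))
lookup-graftMax-map p σ is i =
  trans (cong (lookup (graftMax p σ)) (lookup-map-punchIn p is i))
        (lookup-graft-off p _ σ (lookup is i))

lookup-graftMax-graft-at : (p : Fin (suc n)) (p′ : Fin (suc k)) (σ : Word n n) (is : Word n k) →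
  lookup (graftMax p σ) (lookup (graft p′ p is) p′) ≡ fromℕ n
lookup-graftMax-graft-at p p′ σ is =
  trans (cong (lookup (graftMax p σ)) (lookup-graft-at p′ p is)) (lookup-graft-at p _ σ)

lookup-graftMax-graft-off : (p : Fin (suc n)) (p′ : Fin (suc k)) (σ : Word n n) (is : Word n k)
  (i : Fin k) →
  lookup (graftMax p σ) (lookup (graft p′ p is) (punchIn p′ i)) ≡
  punchIn (fromℕ n) (lookup σ (lookup is i))
lookup-graftMax-graft-off p p′ σ is i =
  trans (cong (lookup (graftMax p σ)) (lookup-graft-off p′ p is i))
        (lookup-graft-off p _ σ (lookup is i))

-- Shifted positions miss the new maximum, so they read the old letters through the order embedding
-- `punchIn (fromℕ n)`.
SameOrder-map : (p : Fin (suc n)) (r : Word k k) (σ : Word n n) (is : Word n k) →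
  SameOrder r (graftMax p σ) (Vec.map (punchIn p) is) ⇔ SameOrder r σ is
SameOrder-map p r σ is = mk⇔
  (λ same j l → ⇔.trans (same j l) (<⇔ j l))
  (λ same j l → ⇔.trans (same j l) (⇔.sym (<⇔ j l)))
  where
  <⇔ : ∀ j l → _
  <⇔ j l = punchIn-<-⇔ (fromℕ _) (lookup-graftMax-map p σ is j) (lookup-graftMax-map p σ is l)

-- Index `p′` carries the maximum of the pattern and also that of the word, so every comparison
-- involving it has the same truth value on both sides. The position `p` is arbitrary: it is an end
-- when occurrences are counted, and interior in `peak-∈`.
SameOrder-graft : (p : Fin (suc n)) (p′ : Fin (suc k)) (q : Word k k) (σ : Word n n)
  (is : Word n k) →
  SameOrder (graftMax p′ q) (graftMax p σ) (graft p′ p is) ⇔ SameOrder q σ is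
SameOrder-graft {n} {k} p p′ q σ is = mk⇔
  (λ same j l → ⇔.trans (⇔.sym (q<⇔ j l)) (⇔.trans (same (punchIn p′ j) (punchIn p′ l)) (σ<⇔ j l)))
  (λ same j l → grafted same (punchView p′ j) (punchView p′ l))
  where
  q<⇔ : ∀ j l → (lookup (graftMax p′ q) (punchIn p′ j) < lookup (graftMax p′ q) (punchIn p′ l)) ⇔
                (lookup q j < lookup q l)
  q<⇔ j l = punchIn-<-⇔ (fromℕ k) (lookup-graft-off p′ _ q j) (lookup-graft-off p′ _ q l)

  σ<⇔ : ∀ j l → _
  σ<⇔ j l = punchIn-<-⇔ (fromℕ n)
    (lookup-graftMax-graft-off p p′ σ is j) (lookup-graftMax-graft-off p p′ σ is l)

  grafted : SameOrder q σ is → ∀ {j l} → PunchView p′ j → PunchView p′ l →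
    (lookup (graftMax p′ q) j < lookup (graftMax p′ q) l) ⇔
    (lookup (graftMax p σ) (lookup (graft p′ p is) j) <
     lookup (graftMax p σ) (lookup (graft p′ p is) l))
  grafted same at at
    rewrite lookup-graft-at p′ (fromℕ k) q | lookup-graftMax-graft-at p p′ σ is
    = mk⇔ (fromℕ≮ _) (fromℕ≮ _)
  grafted same at (off l)
    rewrite lookup-graft-at p′ (fromℕ k) q | lookup-graftMax-graft-at p p′ σ is
    = mk⇔ (fromℕ≮ _) (fromℕ≮ _)
  grafted same (off j) at
    rewrite lookup-graft-at p′ (fromℕ k) q | lookup-graftMax-graft-at p p′ σ is
          | lookup-graft-off p′ (fromℕ k) q j | lookup-graftMax-graft-off p p′ σ is j
    = mk⇔ (λ _ → punchIn-fromℕ< _) (λ _ → punchIn-fromℕ< _)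
  grafted same (off j) (off l) = ⇔.trans (q<⇔ j l) (⇔.trans (same j l) (⇔.sym (σ<⇔ j l)))

-- Occurrences after inserting a maximum at an end.

-- Opaque so that conversion checking does not unfold the decision procedures.

opaque
  occurrenceList : Word k k → Word n n → List (Word n k)
  occurrenceList q σ = filter (isOccurrence? q σ) (words _ _)

  length-occurrenceList : (q : Word k k) (σ : Word n n) →
    length (occurrenceList q σ) ≡ occurrences q σ
  length-occurrenceList q σ = refl

  occurrenceList-unique : (q : Word k k) (σ : Word n n) → UniqueList (occurrenceList q σ)
  occurrenceList-unique q σ = UniqueListₚ.filter⁺ (isOccurrence? q σ) (words-unique _ _)

  ∈-occurrenceList : (q : Word k k) (σ : Word n n) {is : Word n k} →
    is ∈ occurrenceList q σ ⇔ (Increasing is × SameOrder q σ is)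
  ∈-occurrenceList q σ {is} = mk⇔
    (λ is∈ → let (linked , same) = proj₂ (to (∈-filter-⇔ (isOccurrence? q σ) (words _ _) is) is∈)
             in Linked⇒Increasing is linked , same)
    (λ (inc , same) → from (∈-filter-⇔ (isOccurrence? q σ) (words _ _) is)
      (∈-words is , Increasing⇒Linked is inc , same))

#occurrences : Word k k → Word n n → ℕ
#occurrences q σ = length (occurrenceList q σ)

module _ (e : End) where

  private
    graftEnd : Word n n → Word (suc n) (suc n)
    graftEnd = graftMax (end e)

    graftEnd′ : Word n k → Word (suc n) (suc k)
    graftEnd′ = graft (end e) (end e)

    map-∈ : (r : Word k k) (σ : Word n n) {is : Word n k} →
      Vec.map (punchIn (end e)) is ∈ occurrenceList r (graftEnd σ) ⇔ is ∈ occurrenceList r σ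
    map-∈ r σ {is} = ⇔.trans (∈-occurrenceList r (graftEnd σ)) (⇔.trans
      (Increasing-map-punchIn (end e) is ×-⇔ SameOrder-map (end e) r σ is)
      (⇔.sym (∈-occurrenceList r σ)))

    graft-∈ : (q : Word k k) (σ : Word n n) {is : Word n k} →
      graftEnd′ is ∈ occurrenceList (graftEnd q) (graftEnd σ) ⇔ is ∈ occurrenceList q σ
    graft-∈ q σ {is} = ⇔.trans (∈-occurrenceList (graftEnd q) (graftEnd σ)) (⇔.trans
      (Increasing-graft e is ×-⇔ SameOrder-graft (end e) (end e) q σ is)
      (⇔.sym (∈-occurrenceList q σ)))

    map≢graft : {is : Word n (suc k)} {js : Word n k} →
      Vec.map (punchIn (end e)) is ≢ graftEnd′ js
    map≢graft {is = is} {js} eq = punchInᵢ≢i (end e) (lookup is (end e)) (begin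
      punchIn (end e) (lookup is (end e))           ≡⟨ lookup-map-punchIn (end e) is (end e) ⟨
      lookup (Vec.map (punchIn (end e)) is) (end e) ≡⟨ cong (λ w → lookup w (end e)) eq ⟩
      lookup (graftEnd′ js) (end e)                 ≡⟨ lookup-graft-at (end e) (end e) js ⟩
      end e                                         ∎)
      where open ≡-Reasoning

    -- Occurrences missing the new position are those of `r` in `σ`; those using it are parametrised
    -- by `js`. Leaving `js` free covers both cases: the occurrences of the shorter pattern when the
    -- maxima sit at the same end, and the empty list otherwise.
    occurrences-split : (r : Word (suc k) (suc k)) (σ : Word n n) (js : List (Word n k)) →
      UniqueList js →
      (∀ {is} → graftEnd′ is ∈ occurrenceList r (graftEnd σ) ⇔ is ∈ js) →
      #occurrences r (graftEnd σ) ≡ #occurrences r σ + length js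
    occurrences-split r σ js js! graft-∈′ = begin
      #occurrences r (graftEnd σ)
        ≡⟨ ↭ₚ.↭-length (↭-map-++-map
             (occurrenceList-unique r (graftEnd σ)) (occurrenceList-unique r σ) js!
             (map-punchIn-injective (end e)) (graft-injective (end e) (end e)) map≢graft
             split (from (map-∈ r σ)) (from graft-∈′)) ⟩
      length (map (Vec.map (punchIn (end e))) (occurrenceList r σ) ++ map graftEnd′ js)
        ≡⟨ length-++ (map (Vec.map (punchIn (end e))) (occurrenceList r σ)) ⟩
      length (map (Vec.map (punchIn (end e))) (occurrenceList r σ)) + length (map graftEnd′ js)
        ≡⟨ cong₂ _+_ (length-map _ (occurrenceList r σ)) (length-map graftEnd′ js) ⟩
      #occurrences r σ + length js
        ∎
      where
      open ≡-Reasoning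
      split : ∀ {is} → is ∈ occurrenceList r (graftEnd σ) →
        (∃ λ hs → hs ∈ occurrenceList r σ × is ≡ Vec.map (punchIn (end e)) hs) ⊎
        (∃ λ hs → hs ∈ js × is ≡ graftEnd′ hs)
      split {is} is∈ with increasing-split e is (proj₁ (to (∈-occurrenceList r (graftEnd σ)) is∈))
      ... | inj₁ (hs , refl) = inj₁ (hs , to (map-∈ r σ) is∈ , refl)
      ... | inj₂ (hs , refl) = inj₂ (hs , to graft-∈′ is∈ , refl)

  occurrences-same-end : (q : Word k k) (σ : Word n n) →
    #occurrences (graftMax (end e) q) (graftMax (end e) σ) ≡
    #occurrences (graftMax (end e) q) σ + #occurrences q σ
  occurrences-same-end q σ = occurrences-split (graftEnd q) σ
    (occurrenceList q σ) (occurrenceList-unique q σ) (graft-∈ q σ)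

  -- The new maximum of the word could only play the role of the pattern's maximum.
  occurrences-other-end : {p : Fin (suc k)} → p ≢ end e → (q : Word k k) (σ : Word n n) →
    #occurrences (graftMax p q) (graftMax (end e) σ) ≡ #occurrences (graftMax p q) σ
  occurrences-other-end {p = p} p≢e q σ =
    trans (occurrences-split r σ [] [] (mk⇔ (λ is∈ → impossible is∈) λ ())) (ℕₚ.+-identityʳ _)
    where
    r = graftMax p q

    impossible : ∀ {is} → graftEnd′ is ∈ occurrenceList r (graftEnd σ) → A
    impossible {is = is} is∈ = fromℕ≮ _
      (subst (_< lookup (graftEnd σ) (lookup (graftEnd′ is) p))
        (lookup-graftMax-graft-at (end e) (end e) σ is)
        (to (proj₂ (to (∈-occurrenceList r (graftEnd σ)) is∈) (end e) p)
          (lookup-graftMax-< q (p≢e ∘ sym))))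

-- Permutations and the position of their maximum.

permutation-injective : {σ : Word n n} → IsPermutation σ → ∀ i j → lookup σ i ≡ lookup σ j → i ≡ j
permutation-injective = Uniqueₚ.lookup-injective

injective⇒permutation : (σ : Word n n) → (∀ i j → lookup σ i ≡ lookup σ j → i ≡ j) → IsPermutation σ
injective⇒permutation σ inj =
  subst Unique (tabulate∘lookup σ) (Uniqueₚ.tabulate⁺ λ {i} {j} → inj i j)

IsPermutation-graftMax : (p : Fin (suc n)) (σ : Word n n) →
  IsPermutation (graftMax p σ) ⇔ IsPermutation σ
IsPermutation-graftMax {n} p σ = mk⇔
  (λ perm → injective⇒permutation σ λ i j eq → punchIn-injective p i j
    (permutation-injective perm _ _ (trans (lookup-graft-off p _ σ i)
      (trans (cong (punchIn (fromℕ n)) eq) (sym (lookup-graft-off p _ σ j))))))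
  (λ perm → injective⇒permutation (graftMax p σ) λ i j →
    grafted perm (punchView p i) (punchView p j))
  where
  grafted : IsPermutation σ → ∀ {i j} → PunchView p i → PunchView p j →
    lookup (graftMax p σ) i ≡ lookup (graftMax p σ) j → i ≡ j
  grafted perm at      at      _  = refl
  grafted perm at      (off j) eq =
    contradiction (lookup-graftMax-< σ (punchInᵢ≢i p j)) (<-irrefl (sym eq))
  grafted perm (off i) at      eq =
    contradiction (lookup-graftMax-< σ (punchInᵢ≢i p i)) (<-irrefl eq)
  grafted perm (off i) (off j) eq = cong (punchIn p) (permutation-injective perm i j
    (punchIn-injective (fromℕ n) _ _
      (trans (sym (lookup-graft-off p _ σ i)) (trans eq (lookup-graft-off p _ σ j)))))

-- The largest letter occurs by the pigeonhole principle, since otherwise `σ` would give an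
-- injection from `Fin (suc n)` into `Fin n`. It occurs only once by injectivity.
permutation⇒graftMax : (σ : Word (suc n) (suc n)) → IsPermutation σ →
  ∃₂ λ p τ → σ ≡ graftMax p τ
permutation⇒graftMax {n} σ perm with any? (λ p → lookup σ p ≟ fromℕ n)
... | yes (p , σp≡) = p , occurs-once⇒graft p (fromℕ n) σ σp≡ λ i ≡σi →
        punchInᵢ≢i p i (permutation-injective perm _ _ (trans (sym ≡σi) (sym σp≡)))
... | no ∄p = contradiction (injective⇒≤ {f = lookup τ} τ-injective) ℕₚ.1+n≰n
  where
  omits = omits⇒map-punchIn (fromℕ n) σ (λ i ≡σi → ∄p (i , sym ≡σi))
  τ     = proj₁ omits

  τ-injective : Injective _≡_ _≡_ (lookup τ)
  τ-injective {i} {j} eq = permutation-injective perm i j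
    (subst (λ w → lookup w i ≡ lookup w j) (sym (proj₂ omits))
      (trans (lookup-map-punchIn _ τ i) (trans (cong (punchIn _) eq)
        (sym (lookup-map-punchIn _ τ j)))))

-- The maximum marks its own position: in `graftMax p′ τ` every position other than `p′` holds a
-- smaller letter. This keeps the insertions at the two ends disjoint.
graftMax-position-injective : {p p′ : Fin (suc n)} {σ τ : Word n n} →
  graftMax p σ ≡ graftMax p′ τ → p ≡ p′
graftMax-position-injective {p = p} {p′} {σ} {τ} eq with punchView p′ p
... | at    = refl
... | off i = contradiction
  (trans (sym (lookup-graft-off p′ _ τ i))
    (trans (cong (λ w → lookup w (punchIn p′ i)) (sym eq)) (lookup-graft-at (punchIn p′ i) _ σ)))
  (punchInᵢ≢i _ _)

-- The permutations avoiding 132 and 231.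

#occurrences≡0 : (q : Word k k) (σ : Word n n) → Avoids q σ ⇔ (#occurrences q σ ≡ 0)
#occurrences≡0 q σ = mk⇔
  (trans (length-occurrenceList q σ)) (trans (sym (length-occurrenceList q σ)))

opaque
  -- General in the two patterns so that the effect of an insertion can be stated for any patterns
  -- of the form `graftMax p q`.
  avoidingBoth : Word k k → Word k k → ∀ n → List (Word n n)
  avoidingBoth q r n = filter (λ σ → avoids? q σ ×-dec avoids? r σ) (S n)

  S[132,231]≡avoidingBoth : ∀ n → S[132,231] n ≡ avoidingBoth p132 p231 n
  S[132,231]≡avoidingBoth n = refl

  avoidingBoth-unique : (q r : Word k k) → ∀ n → UniqueList (avoidingBoth q r n)
  avoidingBoth-unique q r n =
    UniqueListₚ.filter⁺ (λ σ → avoids? q σ ×-dec avoids? r σ) (S-unique n)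

  ∈-avoidingBoth : (q r : Word k k) (σ : Word n n) →
    σ ∈ avoidingBoth q r n ⇔ (IsPermutation σ × #occurrences q σ ≡ 0 × #occurrences r σ ≡ 0)
  ∈-avoidingBoth {n = n} q r σ = ⇔.trans
    (∈-filter-⇔ {P = λ τ → Avoids q τ × Avoids r τ}
      (λ τ → avoids? q τ ×-dec avoids? r τ) (S n) σ)
    (∈-S σ ×-⇔ (#occurrences≡0 q σ ×-⇔ #occurrences≡0 r σ))

-- Without interior peaks the letters first decrease and then increase, whence the name.
valleys : ∀ n → List (Word n n)
valleys = avoidingBoth p132 p231

∈-valleys : {σ : Word n n} →
  σ ∈ valleys n ⇔ (IsPermutation σ × #occurrences p132 σ ≡ 0 × #occurrences p231 σ ≡ 0)
∈-valleys {σ = σ} = ∈-avoidingBoth p132 p231 σ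

total : Word k k → ℕ → ℕ
total q n = sum (map (#occurrences q) (valleys n))

-- The bridge to the opaque lists. The totals at length 1 are obtained by evaluating `f` and
-- crossing it.
f≡total : (q : Word k k) → ∀ n → f q n ≡ total q n
f≡total q n = trans (cong (λ L → sum (map (occurrences q) L)) (S[132,231]≡avoidingBoth n))
  (cong sum (map-cong (λ σ → sym (length-occurrenceList q σ)) (valleys n)))

avoidingBoth-graftMax-end : ∀ e {p p′ : Fin (suc k)} → p ≢ end e → p′ ≢ end e →
  (q r : Word k k) (σ : Word n n) →
  graftMax (end e) σ ∈ avoidingBoth (graftMax p q) (graftMax p′ r) (suc n) ⇔
  σ ∈ avoidingBoth (graftMax p q) (graftMax p′ r) n
avoidingBoth-graftMax-end e {p} {p′} p≢e p′≢e q r σ =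
  ⇔.trans (∈-avoidingBoth (graftMax p q) (graftMax p′ r) (graftMax (end e) σ))
  (⇔.trans (IsPermutation-graftMax (end e) σ ×-⇔ avoids p≢e q ×-⇔ avoids p′≢e r)
  (⇔.sym (∈-avoidingBoth (graftMax p q) (graftMax p′ r) σ)))
  where
  avoids : ∀ {p} → p ≢ end e → ∀ q →
    (#occurrences (graftMax p q) (graftMax (end e) σ) ≡ 0) ⇔ (#occurrences (graftMax p q) σ ≡ 0)
  avoids p≢e q = mk⇔ (trans (sym eq)) (trans eq)
    where eq = occurrences-other-end e p≢e q σ

-- The patterns 132 and 231 are 12 and 21 with a maximum inserted at the middle index `1F`, which is
-- neither end, so inserting a maximum at an end of the word creates no occurrence of them.
graftMax-end-∈ : ∀ e (σ : Word n n) →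
  graftMax (end e) σ ∈ valleys (suc n) ⇔ σ ∈ valleys n
graftMax-end-∈ e σ =
  avoidingBoth-graftMax-end e (1F≢end e) (1F≢end e) (0F ∷ 1F ∷ []) (1F ∷ 0F ∷ []) σ
  where
  1F≢end : ∀ e → 1F ≢ end {2} e
  1F≢end first ()
  1F≢end last  ()

avoids⇒∉ : {q : Word k k} {σ : Word n n} {is : Word n k} →
  #occurrences q σ ≡ 0 → is ∈ occurrenceList q σ → A
avoids⇒∉ avoids is∈ = contradiction (sym avoids) (ℕₚ.<⇒≢ (∈-length is∈))

-- The hypotheses put `p` between the other two positions, so the maximum is the middle letter read;
-- `q` records the order of the two flanking letters.
peak-∈ : {p : Fin (suc n)} {a b : Fin n} {τ : Word n n} →
  punchIn p a < p → p < punchIn p b →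
  (q : Word 2 2) → SameOrder q τ (a ∷ b ∷ []) →
  graft 1F p (a ∷ b ∷ []) ∈ occurrenceList (graftMax 1F q) (graftMax p τ)
peak-∈ {p = p} {a} {b} {τ} a<p p<b q same =
  from (∈-occurrenceList (graftMax 1F q) (graftMax p τ))
    ( Linked⇒Increasing (punchIn p a ∷ p ∷ punchIn p b ∷ []) (a<p ∷ p<b ∷ [-])
    , from (SameOrder-graft p 1F q τ (a ∷ b ∷ [])) same)

-- A maximum with letters on both sides is the peak of a 132 or a 231.
max-not-between : {p : Fin (suc n)} {a b : Fin n} {τ : Word n n} →
  punchIn p a < p → p < punchIn p b → graftMax p τ ∈ valleys (suc n) → A
max-not-between {n} {p = p} {a} {b} {τ} a<p p<b σ∈ with to ∈-valleys σ∈
... | perm , avoids132 , avoids231 with <-cmp (lookup τ a) (lookup τ b)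
... | tri< τa<τb _ _ = avoids⇒∉ avoids132 (peak-∈ a<p p<b (0F ∷ 1F ∷ []) λ where
          0F 0F → mk⇔ (λ ()) (λ lt → contradiction lt (<-irrefl refl))
          0F 1F → mk⇔ (λ _ → τa<τb) (λ _ → z<s)
          1F 0F → mk⇔ (λ ()) (λ lt → contradiction lt (<-asym τa<τb))
          1F 1F → mk⇔ (λ { (s<s ()) }) (λ lt → contradiction lt (<-irrefl refl)))
... | tri≈ _ τa≡τb _ = contradiction (<-trans {i = punchIn p a} {p} {punchIn p b} a<p p<b)
        (<-irrefl (cong (punchIn p)
          (permutation-injective (to (IsPermutation-graftMax p τ) perm) a b τa≡τb)))
... | tri> _ _ τb<τa = avoids⇒∉ avoids231 (peak-∈ a<p p<b (1F ∷ 0F ∷ []) λ where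
          0F 0F → mk⇔ (λ { (s<s ()) }) (λ lt → contradiction lt (<-irrefl refl))
          0F 1F → mk⇔ (λ ()) (λ lt → contradiction lt (<-asym τb<τa))
          1F 0F → mk⇔ (λ _ → τb<τa) (λ _ → z<s)
          1F 1F → mk⇔ (λ ()) (λ lt → contradiction lt (<-irrefl refl)))

∈-valleys⇒graftMax-end : {σ : Word (suc n) (suc n)} → σ ∈ valleys (suc n) →
  ∃₂ λ e τ → σ ≡ graftMax (end e) τ
∈-valleys⇒graftMax-end {n} {σ} σ∈
  with p , τ , refl ← permutation⇒graftMax σ (proj₁ (to ∈-valleys σ∈)) = max-at-end
  where
  interior : ∀ {i j} → PunchView p i → PunchView p j → i < p → p < j → A
  interior at      _       i<p _   = contradiction i<p (<-irrefl refl)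
  interior (off _) at      _   p<j = contradiction p<j (<-irrefl refl)
  interior (off _) (off _) i<p p<j = max-not-between i<p p<j σ∈

  max-at-end : ∃₂ λ e τ′ → graftMax p τ ≡ graftMax (end e) τ′
  max-at-end with zero ≟ p | p ≟ fromℕ n
  ... | yes refl | _        = first , τ , refl
  ... | no _     | yes refl = last , τ , refl
  -- The first and last positions flank an interior maximum.
  ... | no 0≢p   | no p≢n   = interior (punchView p zero) (punchView p (fromℕ n))
                                (≤∧≢⇒< z≤n 0≢p) (≤∧≢⇒< (≤fromℕ p) p≢n)

-- The length starts at 2 because the two ends coincide when a letter is inserted into the empty
-- word, and the two images would then overlap.
valleys-suc : ∀ n → valleys (2 + n) ↭
  map (graftMax (end first)) (valleys (suc n)) ++ map (graftMax (end last)) (valleys (suc n))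
valleys-suc n = ↭-map-++-map
  (unique (2 + n)) (unique (suc n)) (unique (suc n))
  (graft-injective (end first) _) (graft-injective (end last) _)
  (λ eq → contradiction (graftMax-position-injective {p = end first} {end last} eq) λ ())
  split (from (graftMax-end-∈ first _)) (from (graftMax-end-∈ last _))
  where
  unique = avoidingBoth-unique p132 p231

  split : ∀ {σ} → σ ∈ valleys (2 + n) →
    (∃ λ τ → τ ∈ valleys (suc n) × σ ≡ graftMax (end first) τ) ⊎
    (∃ λ τ → τ ∈ valleys (suc n) × σ ≡ graftMax (end last) τ)
  split σ∈ with ∈-valleys⇒graftMax-end σ∈
  ... | first , τ , refl = inj₁ (τ , to (graftMax-end-∈ first _) σ∈ , refl)
  ... | last  , τ , refl = inj₂ (τ , to (graftMax-end-∈ last _) σ∈ , refl)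

-- The recurrence for the totals.

sum-map-+ : (g h : A → ℕ) (xs : List A) →
  sum (map (λ x → g x + h x) xs) ≡ sum (map g xs) + sum (map h xs)
sum-map-+ g h []       = refl
sum-map-+ g h (x ∷ xs) = trans (cong (g x + h x +_) (sum-map-+ g h xs))
  (interchange (g x) (h x) (sum (map g xs)) (sum (map h xs)))
  where
  interchange : ∀ a b c d → a + b + (c + d) ≡ a + c + (b + d)
  interchange = solve-∀

total-suc : (q : Word k k) (g h : Word (suc n) (suc n) → ℕ) →
  (∀ σ → #occurrences q (graftMax (end first) σ) ≡ g σ) →
  (∀ σ → #occurrences q (graftMax (end last) σ) ≡ h σ) →
  total q (2 + n) ≡ sum (map g (valleys (suc n))) + sum (map h (valleys (suc n)))
total-suc {n = n} q g h at-first at-last = begin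
  total q (2 + n)
    ≡⟨ sum-↭ (↭ₚ.map⁺ (#occurrences q) (valleys-suc n)) ⟩
  sum (map (#occurrences q) (map (graftMax (end first)) L ++ map (graftMax (end last)) L))
    ≡⟨ cong sum (map-++ (#occurrences q) (map (graftMax (end first)) L) _) ⟩
  sum (map (#occurrences q) (map (graftMax (end first)) L) ++
       map (#occurrences q) (map (graftMax (end last)) L))
    ≡⟨ sum-++ (map (#occurrences q) (map (graftMax (end first)) L)) _ ⟩
  sum (map (#occurrences q) (map (graftMax (end first)) L)) +
  sum (map (#occurrences q) (map (graftMax (end last)) L))
    ≡⟨ cong₂ (λ xs ys → sum xs + sum ys)
         (trans (sym (map-∘ L)) (map-cong at-first L))
         (trans (sym (map-∘ L)) (map-cong at-last L)) ⟩
  sum (map g L) + sum (map h L)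
    ∎
  where
  open ≡-Reasoning
  L = valleys (suc n)

-- Insertion at the end of the pattern's own maximum contributes the totals of both patterns,
-- insertion at the other end only repeats that of the longer one. The clauses differ in which end
-- is which.
total-graftMax-end : ∀ e (q : Word (suc k) (suc k)) →
  total (graftMax (end e) q) (2 + n) ≡ 2 * total (graftMax (end e) q) (1 + n) + total q (1 + n)
total-graftMax-end {n = n} first q = begin
  total r (2 + n)
    ≡⟨ total-suc r _ _ (occurrences-same-end first q)
         (occurrences-other-end last {p = end first} (λ ()) q) ⟩
  sum (map (λ σ → #occurrences r σ + #occurrences q σ) (valleys (suc n))) + total r (1 + n)
    ≡⟨ cong (_+ total r (1 + n)) (sum-map-+ (#occurrences r) (#occurrences q) (valleys (suc n))) ⟩
  total r (1 + n) + total q (1 + n) + total r (1 + n)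
    ≡⟨ rearrange (total r (1 + n)) (total q (1 + n)) ⟩
  2 * total r (1 + n) + total q (1 + n)
    ∎
  where
  open ≡-Reasoning
  r = graftMax (end first) q
  rearrange : ∀ a b → a + b + a ≡ 2 * a + b
  rearrange = solve-∀
total-graftMax-end {n = n} last q = begin
  total r (2 + n)
    ≡⟨ total-suc r _ _ (occurrences-other-end first (λ ()) q)
         (occurrences-same-end last q) ⟩
  total r (1 + n) + sum (map (λ σ → #occurrences r σ + #occurrences q σ) (valleys (suc n)))
    ≡⟨ cong (total r (1 + n) +_) (sum-map-+ (#occurrences r) (#occurrences q) (valleys (suc n))) ⟩
  total r (1 + n) + (total r (1 + n) + total q (1 + n))
    ≡⟨ rearrange (total r (1 + n)) (total q (1 + n)) ⟩
  2 * total r (1 + n) + total q (1 + n)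
    ∎
  where
  open ≡-Reasoning
  r = graftMax (end last) q
  rearrange : ∀ a b → a + (a + b) ≡ 2 * a + b
  rearrange = solve-∀

-- Multiplying by `2 ^ k` avoids the truncated exponent `n ∸ k` and covers lengths below `k`, where
-- the binomial coefficient vanishes. Lengths start at 1, as in the recurrence.
ClosedForm : Word k k → Set
ClosedForm {k} q = ∀ n → 2 ^ k * total q (suc n) ≡ (suc n C k) * 2 ^ suc n

-- The patterns of length 0 and 1.

total-[] : ∀ n → total [] (suc n) ≡ 2 ^ n
total-[] zero    = sym (f≡total [] 1)
total-[] (suc n) = begin
  total [] (2 + n)
    ≡⟨ total-suc {n = n} [] (#occurrences []) (#occurrences [])
         (unchanged (end first)) (unchanged (end last)) ⟩
  total [] (1 + n) + total [] (1 + n)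
    ≡⟨ cong₂ _+_ (total-[] n) (total-[] n) ⟩
  2 ^ n + 2 ^ n
    ≡⟨ cong (2 ^ n +_) (ℕₚ.+-identityʳ (2 ^ n)) ⟨
  2 ^ suc n
    ∎
  where
  open ≡-Reasoning
  -- The empty pattern occurs exactly once in every word, so this total counts the permutations
  -- themselves. It is half of what `ClosedForm` would require, hence the induction on patterns
  -- starts at `p1`.
  unchanged : ∀ p (σ : Word (suc n) (suc n)) →
    #occurrences [] (graftMax p σ) ≡ #occurrences [] σ
  unchanged p σ = trans (length-occurrenceList [] (graftMax p σ))
    (sym (length-occurrenceList [] σ))

p1 : Word 1 1
p1 = 0F ∷ []

-- The maximum of a one-letter pattern is at both ends, so both insertions create new occurrences
-- and the second term of the recurrence is doubled.
total-p1 : ∀ n → total p1 (suc n) ≡ suc n * 2 ^ n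
total-p1 zero    = sym (f≡total p1 1)
total-p1 (suc n) = begin
  total p1 (2 + n)
    ≡⟨ total-suc p1 g g (occurrences-same-end first []) (occurrences-same-end last []) ⟩
  sum (map g L) + sum (map g L)
    ≡⟨ cong (λ s → s + s) (sum-map-+ (#occurrences p1) (#occurrences []) L) ⟩
  (total p1 (1 + n) + total [] (1 + n)) + (total p1 (1 + n) + total [] (1 + n))
    ≡⟨ cong₂ (λ a b → (a + b) + (a + b)) (total-p1 n) (total-[] n) ⟩
  (suc n * 2 ^ n + 2 ^ n) + (suc n * 2 ^ n + 2 ^ n)
    ≡⟨ rearrange n (2 ^ n) ⟩
  (2 + n) * 2 ^ suc n
    ∎
  where
  open ≡-Reasoning
  L = valleys (suc n)
  g : Word (suc n) (suc n) → ℕ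
  g σ = #occurrences p1 σ + #occurrences [] σ
  rearrange : ∀ n a → (suc n * a + a) + (suc n * a + a) ≡ (2 + n) * (2 * a)
  rearrange = solve-∀

p1-closedForm : ClosedForm p1
p1-closedForm n = begin
  2 * total p1 (suc n)    ≡⟨ cong (2 *_) (total-p1 n) ⟩
  2 * (suc n * 2 ^ n)     ≡⟨ rearrange (suc n) (2 ^ n) ⟩
  suc n * 2 ^ suc n       ≡⟨ cong (_* 2 ^ suc n) (nC1≡n (suc n)) ⟨
  (suc n C 1) * 2 ^ suc n ∎
  where
  open ≡-Reasoning
  rearrange : ∀ a b → 2 * (a * b) ≡ a * (2 * b)
  rearrange = solve-∀

-- Induction on the length of the permutations: after multiplication by `2 ^ (2 + k)` the recurrence
-- turns into Pascal's rule. The condition at length 1 is phrased with `f`, which evaluates for a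
-- concrete pattern, while `total` is blocked by opacity.
graftMax-closedForm : ∀ e (q : Word (suc k) (suc k)) → f (graftMax (end e) q) 1 ≡ 0 →
  ClosedForm q → ClosedForm (graftMax (end e) q)
graftMax-closedForm {k} e q f1≡0 closed = go
  where
  open ≡-Reasoning
  r = graftMax (end e) q

  expand : ∀ c a b → 2 * c * (2 * a + b) ≡ 2 * (2 * c * a) + 2 * (c * b)
  expand = solve-∀

  collect : ∀ x y c → 2 * (x * c) + 2 * (y * c) ≡ (y + x) * (2 * c)
  collect = solve-∀

  go : ClosedForm r
  go zero = begin
    2 ^ (2 + k) * total r 1 ≡⟨ cong (2 ^ (2 + k) *_) (trans (sym (f≡total r 1)) f1≡0) ⟩
    2 ^ (2 + k) * 0         ≡⟨ ℕₚ.*-zeroʳ (2 ^ (2 + k)) ⟩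
    0                       ≡⟨ cong (_* 2) (k>n⇒nCk≡0 {1} {2 + k} (s≤s (s≤s z≤n))) ⟨
    (1 C (2 + k)) * 2       ∎
  go (suc n) = begin
    2 ^ (2 + k) * total r (2 + n)
      ≡⟨ cong (2 ^ (2 + k) *_) (total-graftMax-end e q) ⟩
    2 ^ (2 + k) * (2 * total r (1 + n) + total q (1 + n))
      ≡⟨ expand (2 ^ suc k) (total r (1 + n)) (total q (1 + n)) ⟩
    2 * (2 ^ (2 + k) * total r (1 + n)) + 2 * (2 ^ (1 + k) * total q (1 + n))
      ≡⟨ cong₂ (λ a b → 2 * a + 2 * b) (go n) (closed n) ⟩
    2 * ((suc n C (2 + k)) * 2 ^ suc n) + 2 * ((suc n C suc k) * 2 ^ suc n)
      ≡⟨ collect (suc n C (2 + k)) (suc n C suc k) (2 ^ suc n) ⟩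
    ((suc n C suc k) + (suc n C (2 + k))) * 2 ^ (2 + n)
      ≡⟨ cong (_* 2 ^ (2 + n)) (nCk+nC[k+1]≡[n+1]C[k+1] (suc n) (suc k)) ⟩
    ((2 + n) C (2 + k)) * 2 ^ (2 + n)
      ∎

-- The patterns of length 2 and 3.

p12 p21 : Word 2 2
p12 = 0F ∷ 1F ∷ []
p21 = 1F ∷ 0F ∷ []

p12-closedForm : ClosedForm p12
p12-closedForm = graftMax-closedForm last p1 refl p1-closedForm

p21-closedForm : ClosedForm p21
p21-closedForm = graftMax-closedForm first p1 refl p1-closedForm

closedForm⇒f : (q : Word 3 3) → ClosedForm q → ∀ n → n ≥ 3 → f q n ≡ (n C 3) * 2 ^ (n ∸ 3)
-- With the length written as `3 + n` the exponent `n ∸ 3` computes, and the common factor `8` is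
-- `2 ^ 3`.
closedForm⇒f q closed (suc (suc (suc n))) (s≤s (s≤s (s≤s _))) = ℕₚ.*-cancelˡ-≡ _ _ 8
  (trans (cong (8 *_) (f≡total q (3 + n))) (trans (closed (2 + n))
    (rearrange ((3 + n) C 3) (2 ^ n))))
  where
  rearrange : ∀ a b → a * (2 * (2 * (2 * b))) ≡ 8 * (a * b)
  rearrange = solve-∀

theorem2p11 : (n : ℕ) → n ≥ 3 →
    (f p123 n ≡ f p213 n) ×
    (f p213 n ≡ f p312 n) ×
    (f p312 n ≡ f p321 n) ×
    (f p321 n ≡ (n C 3) * 2 ^ (n ∸ 3))
theorem2p11 n n≥3 = trans f123 (sym f213) , trans f213 (sym f312) , trans f312 (sym f321) , f321
  where
  -- Each pattern has its largest letter at an end and reduces to 12 or 21 without it; `graftMax`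
  -- applied to these evaluates to the pattern itself.
  f123 = closedForm⇒f p123 (graftMax-closedForm last  p12 refl p12-closedForm) n n≥3
  f213 = closedForm⇒f p213 (graftMax-closedForm last  p21 refl p21-closedForm) n n≥3
  f312 = closedForm⇒f p312 (graftMax-closedForm first p12 refl p12-closedForm) n n≥3
  f321 = closedForm⇒f p321 (graftMax-closedForm first p21 refl p21-closedForm) n n≥3
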